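{- For any splitter network $G=(I\uplus S\uplus O,E)$ and any capacity function $c:I\cup O\to[0,1]$, all steady-states $(t,F)$ for $(G,c)$ have the same restriction of $t$ to $\delta^+(I)\cup\delta^-(O)$ (the arcs leaving inputs and the arcs entering outputs).
   Context: A splitter network is a finite directed graph $G$ (loops and parallel arcs allowed) with arc set $E$ whose vertex set is partitioned as $I\uplus S\uplus O$, where each input $i\in I$ has out-degree $1$ and in-degree $0$, each output $o\in O$ has in-degree $1$ and out-degree $0$, and each splitter $s\in S$ has in-degree $2$ and out-degree $2$. $\delta^+(v),\delta^-(v)$ denote outgoing/incoming arcs of $v$. A steady-state for $(G,c)$ is a pair $(t,F)$ with $t:E\to[0,1]$ and $F\subseteq E$ (fluid arcs; arcs of $E\setminus F$ are saturated) such that: (R3) for each input $i$ with $\delta^+(i)=\{e\}$, $t(e)\le c(i)$, and if $e\in F$ then $t(e)=c(i)$; (R4) for each output $o$ with $\delta^-(o)=\{e\}$, $t(e)\le c(o)$, and if $e\notin F$ then $t(e)=c(o)$; (R5) for each splitter $s$, $t(\delta^-(s))=t(\delta^+(s))$; (R6) for each splitter $s$ with $\delta^-(s)=\{e_1,e_2\}$ and $e_1\notin F$, $t(e_1)\ge t(e_2)$; (R7) for each splitter $s$ with $\delta^+(s)=\{e_1,e_2\}$ and $e_1\in F$, $t(e_1)\ge t(e_2)$; (R8) for any arcs $uv\in E\setminus F$ and $vw\in F$, $t(uv)=1$ or $t(vw)=1$. -}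

module Defs where

open import Level using (0ℓ)
open import Data.Nat using (ℕ)
open import Data.Fin using (Fin)
open import Data.Bool using (Bool; true; false)
open import Data.Product using (Σ; ∃; ∃-syntax; _×_; _,_)
open import Data.Sum using (_⊎_)
open import Relation.Nullary using (¬_)
open import Relation.Binary.PropositionalEquality using (_≡_; _≢_)
open import Algebra.Structures using (IsCommutativeRing)
open import Relation.Binary.Structures using (IsTotalOrder)

record RealField : Set₁ where
  infixl 6 _+_
  infixl 7 _*_
  infix 4 _≤_
  field
    ℝ    : Set
    _+_  : ℝ → ℝ → ℝ
    _*_  : ℝ → ℝ → ℝ
    -_   : ℝ → ℝ
    0ℝ   : ℝ
    1ℝ   : ℝ
    _≤_  : ℝ → ℝ → Set
    isCommutativeRing : IsCommutativeRing _≡_ _+_ _*_ -_ 0ℝ 1ℝ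
    0≢1  : 0ℝ ≢ 1ℝ
    inverse : ∀ x → x ≢ 0ℝ → ∃[ y ] (x * y ≡ 1ℝ)
    isTotalOrder : IsTotalOrder _≡_ _≤_
    +-mono-≤ : ∀ {x y} z → x ≤ y → x + z ≤ y + z
    *-nonneg : ∀ {x y} → 0ℝ ≤ x → 0ℝ ≤ y → 0ℝ ≤ x * y
    complete : (P : ℝ → Set) → ∃[ x ] P x → ∃[ b ] (∀ x → P x → x ≤ b) →
               ∃[ s ] ((∀ x → P x → x ≤ s) × (∀ b → (∀ x → P x → x ≤ b) → s ≤ b))

data Kind : Set where
  input splitter output : Kind

record Digraph : Set where
  field
    nV nE : ℕ
    tail head : Fin nE → Fin nV

module _ (G : Digraph) where
  open Digraph G

  NoArc : (Fin nE → Set) → Set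
  NoArc P = ∀ e → ¬ P e

  ExactlyOneArc : (Fin nE → Set) → Set
  ExactlyOneArc P = ∃[ e ] (P e × (∀ e' → P e' → e' ≡ e))

  ExactlyTwoArcs : (Fin nE → Set) → Set
  ExactlyTwoArcs P = ∃[ e₁ ] ∃[ e₂ ] (e₁ ≢ e₂ × P e₁ × P e₂ ×
                       (∀ e → P e → e ≡ e₁ ⊎ e ≡ e₂))

  Out In : Fin nV → Fin nE → Set
  Out v e = tail e ≡ v
  In  v e = head e ≡ v

  IsSplitterNetwork : (Fin nV → Kind) → Set
  IsSplitterNetwork kind = ∀ v →
    (kind v ≡ input    → ExactlyOneArc (Out v) × NoArc (In v)) ×
    (kind v ≡ output   → ExactlyOneArc (In v)  × NoArc (Out v)) ×
    (kind v ≡ splitter → ExactlyTwoArcs (In v) × ExactlyTwoArcs (Out v))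

record SplitterNetwork : Set where
  field
    graph : Digraph
  open Digraph graph public
  field
    kind : Fin nV → Kind
    wellFormed : IsSplitterNetwork graph kind

-- Steady states.  t : E → [0,1], F ⊆ E given by its indicator
-- (fluid e ≡ true iff e ∈ F).  Capacities c are given on all vertices
-- (values on splitters are irrelevant) and lie in [0,1].

module _ (R : RealField) where
  open RealField R

  InUnit : ℝ → Set
  InUnit x = 0ℝ ≤ x × x ≤ 1ℝ

  module _ (N : SplitterNetwork) where
    open SplitterNetwork N

    record IsSteadyState (c : Fin nV → ℝ) (t : Fin nE → ℝ)
                         (fluid : Fin nE → Bool) : Set where
      field
        range : ∀ e → InUnit (t e)
        R3 : ∀ i e → kind i ≡ input → tail e ≡ i →
               t e ≤ c i × (fluid e ≡ true → t e ≡ c i)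
        R4 : ∀ o e → kind o ≡ output → head e ≡ o →
               t e ≤ c o × (fluid e ≡ false → t e ≡ c o)
        R5 : ∀ s e₁ e₂ f₁ f₂ → kind s ≡ splitter →
               e₁ ≢ e₂ → head e₁ ≡ s → head e₂ ≡ s →
               f₁ ≢ f₂ → tail f₁ ≡ s → tail f₂ ≡ s →
               t e₁ + t e₂ ≡ t f₁ + t f₂
        R6 : ∀ s e₁ e₂ → kind s ≡ splitter →
               e₁ ≢ e₂ → head e₁ ≡ s → head e₂ ≡ s →
               fluid e₁ ≡ false → t e₂ ≤ t e₁
        R7 : ∀ s e₁ e₂ → kind s ≡ splitter →
               e₁ ≢ e₂ → tail e₁ ≡ s → tail e₂ ≡ s →
               fluid e₁ ≡ true → t e₂ ≤ t e₁
        R8 : ∀ e f → head e ≡ tail f → fluid e ≡ false → fluid f ≡ true →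
               t e ≡ 1ℝ ⊎ t f ≡ 1ℝ

    Boundary : Fin nE → Set
    Boundary e = kind (tail e) ≡ input ⊎ kind (head e) ≡ output

{-# OPTIONS --safe #-}

-- An arc is read as a traffic-flow density: fluid arcs carry t at low density,
-- saturated arcs carry t at high density.  For two steady states, Kruzkov's
-- entropy flux is sign(ρ' - ρ) (t' - t), where ρ = t on fluid arcs and
-- ρ = 2 - t on saturated ones.  At every vertex the outgoing flux is at most
-- the incoming one, the flux leaving an input is -|t' - t|, and the flux
-- entering an output is |t' - t|.  Summing over all vertices gives equality at
-- each vertex, so t and t' agree on the boundary.
module Submission where

open import Defs
open import Algebra.Bundles using (AbelianGroup)
open import Algebra.Structures using (module IsCommutativeRing)
import Algebra.Properties.AbelianGroup as AbelianGroupProperties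
import Algebra.Properties.CommutativeMonoid.Sum as SumProperties
import Algebra.Properties.CommutativeSemigroup as CommutativeSemigroupProperties
open import Data.Bool using (Bool; true; false; not; if_then_else_)
open import Data.Bool.Properties using (¬-not) renaming (_≟_ to _≟ᵇ_)
open import Data.Fin using (Fin; zero; suc)
open import Data.Fin.Properties using (_≟_)
open import Data.Nat using (zero; suc)
open import Data.Product using (_×_; _,_; proj₁; proj₂)
open import Data.Sum as Sum using (_⊎_; inj₁; inj₂; [_,_]′)
open import Function using (_∘_)
open import Relation.Binary.Bundles using (Poset)
import Relation.Binary.Reasoning.PartialOrder as PosetReasoning
open import Relation.Binary.PropositionalEquality
  using (_≡_; _≢_; refl; sym; trans; cong; cong₂; subst; subst₂; ≢-sym; module ≡-Reasoning)
open import Relation.Binary.Structures using (IsTotalOrder)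
open import Relation.Nullary using (¬_; Dec; yes; no; does; contradiction)
open import Relation.Nullary.Decidable using (dec-true; dec-false)

-- The ordered additive group of the reals, and finite sums in it.

module OrderedGroup (R : RealField) where
  open RealField R public
  open IsTotalOrder isTotalOrder public
    using (total; antisym; isPartialOrder)
    renaming (refl to ≤-refl; trans to ≤-trans)

  +-abelianGroup : AbelianGroup _ _
  +-abelianGroup = record
    { isAbelianGroup = IsCommutativeRing.+-isAbelianGroup isCommutativeRing }

  open AbelianGroup +-abelianGroup public
    using (_-_; commutativeMonoid; commutativeSemigroup)
    renaming (comm to +-comm; identityˡ to +-identityˡ;
              identityʳ to +-identityʳ; inverseˡ to +-inverseˡ; inverseʳ to +-inverseʳ)
  open AbelianGroupProperties +-abelianGroup public
    using (⁻¹-∙-comm; //-rightDividesʳ)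
    renaming (∙-cancelˡ to +-cancelˡ)
  open CommutativeSemigroupProperties commutativeSemigroup public using (interchange)
  open SumProperties commutativeMonoid public
    using (sum; sum-syntax; sum-cong-≗; sum-replicate-zero; ∑-distrib-+; ∑-comm)

  ≤-poset : Poset _ _ _
  ≤-poset = record { isPartialOrder = isPartialOrder }

  module ≤-Reasoning = PosetReasoning ≤-poset

  +-mono₂-≤ : ∀ {a b c d} → a ≤ b → c ≤ d → a + c ≤ b + d
  +-mono₂-≤ {a} {b} {c} {d} a≤b c≤d = ≤-trans (+-mono-≤ c a≤b)
    (subst₂ _≤_ (+-comm c b) (+-comm d b) (+-mono-≤ b c≤d))

  +-cancelʳ-≤ : ∀ {a b} c → a + c ≤ b + c → a ≤ b
  +-cancelʳ-≤ {a} {b} c p =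
    subst₂ _≤_ (//-rightDividesʳ c a) (//-rightDividesʳ c b) (+-mono-≤ (- c) p)

  -‿anti-≤ : ∀ {a b} → a ≤ b → - b ≤ - a
  -‿anti-≤ {a} {b} a≤b = +-cancelʳ-≤ a (begin
    - b + a  ≤⟨ +-mono₂-≤ ≤-refl a≤b ⟩
    - b + b  ≡⟨ +-inverseˡ b ⟩
    0ℝ       ≡⟨ sym (+-inverseˡ a) ⟩
    - a + a  ∎)
    where open ≤-Reasoning

  x≤y⇒x-y≤y-x : ∀ {x y} → x ≤ y → x - y ≤ y - x
  x≤y⇒x-y≤y-x x≤y = +-mono₂-≤ x≤y (-‿anti-≤ x≤y)

  x≤y⇒x-y≤0 : ∀ {x y} → x ≤ y → x - y ≤ 0ℝ
  x≤y⇒x-y≤0 {x} {y} x≤y = subst (x - y ≤_) (+-inverseʳ y) (+-mono-≤ (- y) x≤y)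

  x≤y⇒0≤y-x : ∀ {x y} → x ≤ y → 0ℝ ≤ y - x
  x≤y⇒0≤y-x {x} {y} x≤y = subst (_≤ y - x) (+-inverseʳ x) (+-mono-≤ (- x) x≤y)

  x-y≤0⇒x≤y : ∀ {x y} → x - y ≤ 0ℝ → x ≤ y
  x-y≤0⇒x≤y {x} {y} p = +-cancelʳ-≤ (- y) (subst (x - y ≤_) (sym (+-inverseʳ y)) p)

  0≤x-y⇒y≤x : ∀ {x y} → 0ℝ ≤ x - y → y ≤ x
  0≤x-y⇒y≤x {x} {y} p = +-cancelʳ-≤ (- y) (subst (_≤ x - y) (sym (+-inverseʳ y)) p)

  +-minus-interchange : ∀ a b c d → (a - b) + (c - d) ≡ (a + c) - (b + d)
  +-minus-interchange a b c d =
    trans (interchange a (- b) c (- d)) (cong ((a + c) +_) (⁻¹-∙-comm b d))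

  +-≤-≡⇒≡ : ∀ {a b c d} → a ≤ b → c ≤ d → a + c ≡ b + d → a ≡ b × c ≡ d
  +-≤-≡⇒≡ {a} {b} {c} {d} a≤b c≤d eq = a≡b , c≡d
    where
    a≡b : a ≡ b
    a≡b = antisym a≤b (+-cancelʳ-≤ d (subst (_≤ a + d) eq (+-mono₂-≤ ≤-refl c≤d)))
    c≡d : c ≡ d
    c≡d = +-cancelˡ b c d (trans (cong (_+ c) (sym a≡b)) eq)

  -- A strict inequality in a single term would survive summation. This turns the balance of the
  -- totals into a balance at each vertex.
  ∑-≤-≡⇒≗ : ∀ {n} (f g : Fin n → ℝ) → (∀ i → f i ≤ g i) → sum f ≡ sum g →
            ∀ i → f i ≡ g i
  ∑-≤-≡⇒≗ {suc n} f g f≤g eq = go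
    where
    sum-mono : ∀ {m} (f g : Fin m → ℝ) → (∀ i → f i ≤ g i) → sum f ≤ sum g
    sum-mono {zero} f g f≤g = ≤-refl
    sum-mono {suc m} f g f≤g =
      +-mono₂-≤ (f≤g zero) (sum-mono (f ∘ suc) (g ∘ suc) (f≤g ∘ suc))

    split = +-≤-≡⇒≡ (f≤g zero) (sum-mono (f ∘ suc) (g ∘ suc) (f≤g ∘ suc)) eq

    go : ∀ i → f i ≡ g i
    go zero    = proj₁ split
    go (suc i) = ∑-≤-≡⇒≗ (f ∘ suc) (g ∘ suc) (f≤g ∘ suc) (proj₂ split) i

-- Sums over the fibres of a map between finite sets.

module FibreSums (R : RealField) where
  open OrderedGroup R

  restrict : ∀ {P : Set} → Dec P → ℝ → ℝ
  restrict P? x = if does P? then x else 0ℝ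

  restrict-yes : ∀ {P : Set} (P? : Dec P) x → P → restrict P? x ≡ x
  restrict-yes P? x p = cong (if_then x else 0ℝ) (dec-true P? p)

  restrict-no : ∀ {P : Set} (P? : Dec P) x → ¬ P → restrict P? x ≡ 0ℝ
  restrict-no P? x ¬p = cong (if_then x else 0ℝ) (dec-false P? ¬p)

  ∑-restrict : ∀ {n} (i : Fin n) x → ∑[ j < n ] restrict (i ≟ j) x ≡ x
  ∑-restrict {suc n} zero    x = trans (cong (x +_) (sum-replicate-zero n)) (+-identityʳ x)
  ∑-restrict {suc n} (suc i) x = trans (+-identityˡ _) (∑-restrict i x)

  module _ {m n} (h : Fin m → Fin n) (f : Fin m → ℝ) where

    -- The sum runs over all of `Fin m`, with zeros off the fibre, so that it can be exchanged with
    -- a sum over `v`.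
    ∑fibre : Fin n → ℝ
    ∑fibre v = ∑[ e < m ] restrict (h e ≟ v) (f e)

    -- Each `e` lies in exactly one fibre, so after the exchange the inner sum over `v` picks up
    -- `f e` once.
    ∑-∑fibre : sum ∑fibre ≡ sum f
    ∑-∑fibre = trans (∑-comm (λ v e → restrict (h e ≟ v) (f e)))
                     (sum-cong-≗ (λ e → ∑-restrict (h e) (f e)))

    ∑fibre-none : ∀ {v} → (∀ e → h e ≢ v) → ∑fibre v ≡ 0ℝ
    ∑fibre-none {v} none =
      trans (sum-cong-≗ (λ e → restrict-no (h e ≟ v) (f e) (none e))) (sum-replicate-zero m)

    ∑fibre-one : ∀ {v e₀} → h e₀ ≡ v → (∀ e → h e ≡ v → e ≡ e₀) → ∑fibre v ≡ f e₀
    ∑fibre-one {v} {e₀} he₀ unique = trans (sum-cong-≗ pointwise) (∑-restrict e₀ (f e₀))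
      where
      pointwise : ∀ e → restrict (h e ≟ v) (f e) ≡ restrict (e₀ ≟ e) (f e₀)
      pointwise e with e₀ ≟ e
      ... | yes refl = restrict-yes (h e ≟ v) (f e) he₀
      ... | no e₀≢e  = restrict-no (h e ≟ v) (f e) (e₀≢e ∘ sym ∘ unique e)

    ∑fibre-two : ∀ {v e₁ e₂} → e₁ ≢ e₂ → h e₁ ≡ v → h e₂ ≡ v →
                 (∀ e → h e ≡ v → e ≡ e₁ ⊎ e ≡ e₂) → ∑fibre v ≡ f e₁ + f e₂
    ∑fibre-two {v} {e₁} {e₂} e₁≢e₂ he₁ he₂ only =
      trans (sum-cong-≗ pointwise)
        (trans (∑-distrib-+ (λ e → restrict (e₁ ≟ e) (f e₁)) (λ e → restrict (e₂ ≟ e) (f e₂)))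
               (cong₂ _+_ (∑-restrict e₁ (f e₁)) (∑-restrict e₂ (f e₂))))
      where
      pointwise : ∀ e → restrict (h e ≟ v) (f e) ≡
                        restrict (e₁ ≟ e) (f e₁) + restrict (e₂ ≟ e) (f e₂)
      pointwise e with e₁ ≟ e | e₂ ≟ e
      ... | yes refl | yes refl = contradiction refl e₁≢e₂
      ... | yes refl | no _     = trans (restrict-yes (h e ≟ v) (f e) he₁) (sym (+-identityʳ _))
      ... | no _     | yes refl = trans (restrict-yes (h e ≟ v) (f e) he₂) (sym (+-identityˡ _))
      ... | no e₁≢e  | no e₂≢e  =
        trans (restrict-no (h e ≟ v) (f e) ([ e₁≢e ∘ sym , e₂≢e ∘ sym ]′ ∘ only e))
              (sym (+-identityˡ _))

-- The flux of a single arc and its one-sided bounds.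

module Flux (R : RealField) where
  open OrderedGroup R

  -- sign(ρ' - ρ) (y - x), for an arc with flow x and fluidity φ in the first
  -- state, and y and ψ in the second one.
  flux : Bool → Bool → ℝ → ℝ → ℝ
  flux true  true  x y = [ (λ _ → y - x) , (λ _ → x - y) ]′ (total x y)
  flux true  false x y = y - x
  flux false true  x y = x - y
  flux false false x y = [ (λ _ → x - y) , (λ _ → y - x) ]′ (total x y)

  -- The flux is always one of `y - x` and `x - y`; each hypothesis of this and the next three
  -- bounds leaves only the cases where it is the right one or has the favourable sign. Upper bounds
  -- serve arcs leaving a vertex, lower bounds arcs entering it.
  flux≤y-x : ∀ φ ψ {x y} → ψ ≡ false ⊎ x ≤ y → flux φ ψ x y ≤ y - x
  flux≤y-x true  false _ = ≤-refl
  flux≤y-x false true  (inj₂ x≤y) = x≤y⇒x-y≤y-x x≤y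
  flux≤y-x true  true  {x} {y} (inj₂ x≤y) with total x y
  ... | inj₁ _ = ≤-refl
  -- A tie: both inequalities hold, so both differences vanish and the branch chosen by `total` is
  -- harmless.
  ... | inj₂ _ = x≤y⇒x-y≤y-x x≤y
  flux≤y-x false false {x} {y} _ with total x y
  ... | inj₁ x≤y = x≤y⇒x-y≤y-x x≤y
  ... | inj₂ _   = ≤-refl

  flux≤x-y : ∀ φ ψ {x y} → φ ≡ false ⊎ y ≤ x → flux φ ψ x y ≤ x - y
  flux≤x-y false true  _ = ≤-refl
  flux≤x-y true  false (inj₂ y≤x) = x≤y⇒x-y≤y-x y≤x
  flux≤x-y true  true  {x} {y} (inj₂ y≤x) with total x y
  ... | inj₁ _ = x≤y⇒x-y≤y-x y≤x
  ... | inj₂ _ = ≤-refl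
  flux≤x-y false false {x} {y} _ with total x y
  ... | inj₁ _   = ≤-refl
  ... | inj₂ y≤x = x≤y⇒x-y≤y-x y≤x

  y-x≤flux : ∀ φ ψ {x y} → φ ≡ true ⊎ y ≤ x → y - x ≤ flux φ ψ x y
  y-x≤flux true  false _ = ≤-refl
  y-x≤flux false true  (inj₂ y≤x) = x≤y⇒x-y≤y-x y≤x
  y-x≤flux true  true  {x} {y} _ with total x y
  ... | inj₁ _   = ≤-refl
  ... | inj₂ y≤x = x≤y⇒x-y≤y-x y≤x
  y-x≤flux false false {x} {y} (inj₂ y≤x) with total x y
  ... | inj₁ _ = x≤y⇒x-y≤y-x y≤x
  ... | inj₂ _ = ≤-refl

  x-y≤flux : ∀ φ ψ {x y} → ψ ≡ true ⊎ x ≤ y → x - y ≤ flux φ ψ x y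
  x-y≤flux false true  _ = ≤-refl
  x-y≤flux true  false (inj₂ x≤y) = x≤y⇒x-y≤y-x x≤y
  x-y≤flux true  true  {x} {y} _ with total x y
  ... | inj₁ x≤y = x≤y⇒x-y≤y-x x≤y
  ... | inj₂ _   = ≤-refl
  x-y≤flux false false {x} {y} (inj₂ x≤y) with total x y
  ... | inj₁ _ = ≤-refl
  ... | inj₂ _ = x≤y⇒x-y≤y-x x≤y

  ≤-differences⇒≤0 : ∀ {x y q} → q ≤ y - x → q ≤ x - y → q ≤ 0ℝ
  ≤-differences⇒≤0 {x} {y} q≤y-x q≤x-y with total x y
  ... | inj₁ x≤y = ≤-trans q≤x-y (x≤y⇒x-y≤0 x≤y)
  ... | inj₂ y≤x = ≤-trans q≤y-x (x≤y⇒x-y≤0 y≤x)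

  differences-≤⇒0≤ : ∀ {x y q} → y - x ≤ q → x - y ≤ q → 0ℝ ≤ q
  differences-≤⇒0≤ {x} {y} y-x≤q x-y≤q with total x y
  ... | inj₁ x≤y = ≤-trans (x≤y⇒0≤y-x x≤y) y-x≤q
  ... | inj₂ y≤x = ≤-trans (x≤y⇒0≤y-x y≤x) x-y≤q

-- Comparison of two steady states on one network.

module Comparison (R : RealField) (N : SplitterNetwork) where
  open OrderedGroup R
  open FibreSums R
  open Flux R
  open SplitterNetwork N

  private
    Flow     = Fin nE → ℝ
    Fluidity = Fin nE → Bool

  -- For `b = true` this is the hypothesis of the lower flux bounds, for `b = false` that of the
  -- upper ones. Exchanging the two states exchanges the bounds by `t' - t` and by `t - t'`.
  Slack : Bool → Fluidity → Flow → Flow → Fin nE → Set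
  Slack b F t t' e = F e ≡ b ⊎ t' e ≤ t e

  Both : (Fin nE → Set) → Fin nE → Fin nE → Set
  Both P e f = P e × P f

  -- R6 is the instance `b = false` on incoming pairs, R7 the instance `b = true` on outgoing pairs.
  DominatesPartner : Bool → Fluidity → Flow → Fin nE → Fin nE → Set
  DominatesPartner b F t e f = F e ≡ b → t f ≤ t e

  ≡⊎≡not : ∀ x b → x ≡ b ⊎ x ≡ not b
  ≡⊎≡not x b with x ≟ᵇ b
  ... | yes x≡b = inj₁ x≡b
  ... | no  x≢b = inj₂ (¬-not x≢b)

  -- R6 and R7 prevent the two arcs of a pair from jumping in opposite
  -- directions with the wrong fluidities.
  slack-pair : ∀ b F F' t t' {e f} →
    DominatesPartner (not b) F t e f → DominatesPartner (not b) F t f e →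
    DominatesPartner (not b) F' t' e f → DominatesPartner (not b) F' t' f e →
    Both (Slack b F t t') e f ⊎ Both (Slack b F' t' t) e f
  slack-pair b F F' t t' {e} {f} Fe Ff F'e F'f with total (t e) (t' e) | total (t f) (t' f)
  ... | inj₁ te≤t'e | inj₁ tf≤t'f = inj₂ (inj₂ te≤t'e , inj₂ tf≤t'f)
  ... | inj₂ t'e≤te | inj₂ t'f≤tf = inj₁ (inj₂ t'e≤te , inj₂ t'f≤tf)
  ... | inj₁ te≤t'e | inj₂ t'f≤tf with ≡⊎≡not (F e) b | ≡⊎≡not (F' f) b
  ...   | inj₁ Fe≡b | _          = inj₁ (inj₁ Fe≡b , inj₂ t'f≤tf)
  ...   | inj₂ _    | inj₁ F'f≡b = inj₂ (inj₂ te≤t'e , inj₁ F'f≡b)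
  -- Both dominations apply and give `t f ≤ t e ≤ t' e ≤ t' f`, so `f` does not decrease after all.
  ...   | inj₂ Fe≢b | inj₂ F'f≢b =
    inj₂ (inj₂ te≤t'e , inj₂ (≤-trans (Fe Fe≢b) (≤-trans te≤t'e (F'f F'f≢b))))
  slack-pair b F F' t t' {e} {f} Fe Ff F'e F'f | inj₂ t'e≤te | inj₁ tf≤t'f
    with ≡⊎≡not (F f) b | ≡⊎≡not (F' e) b
  ...   | inj₁ Ff≡b | _          = inj₁ (inj₂ t'e≤te , inj₁ Ff≡b)
  ...   | inj₂ _    | inj₁ F'e≡b = inj₂ (inj₁ F'e≡b , inj₂ tf≤t'f)
  ...   | inj₂ Ff≢b | inj₂ F'e≢b =
    inj₂ (inj₂ (≤-trans (Ff Ff≢b) (≤-trans tf≤t'f (F'e F'e≢b))) , inj₂ tf≤t'f)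

  module _ {c : Fin nV → ℝ} {t t' : Flow} {F : Fluidity}
           (S : IsSteadyState R N c t F) (t'≤1 : ∀ e → t' e ≤ 1ℝ) where
    open IsSteadyState S

    -- Only a saturated arc followed by a fluid one needs R8, which puts one of them at flow 1, a
    -- value that `t'` cannot exceed.
    R8-slack : ∀ {e f} → head e ≡ tail f → Slack true F t t' e ⊎ Slack false F t t' f
    R8-slack {e} {f} adj with F e in Fe | F f in Ff
    ... | true  | _     = inj₁ (inj₁ refl)
    ... | false | false = inj₂ (inj₁ refl)
    ... | false | true  = Sum.map (inj₂ ∘ full) (inj₂ ∘ full) (R8 e f adj Fe Ff)
      where
      full : ∀ {g} → t g ≡ 1ℝ → t' g ≤ t g
      full {g} tg≡1 = subst (t' g ≤_) (sym tg≡1) (t'≤1 g)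

    -- If one incoming arc lacks slack, its adjacency to each outgoing arc forces slack on both of
    -- those.
    R8-slack-splitter : ∀ {s e₁ e₂ f₁ f₂} →
      head e₁ ≡ s → head e₂ ≡ s → tail f₁ ≡ s → tail f₂ ≡ s →
      Both (Slack true F t t') e₁ e₂ ⊎ Both (Slack false F t t') f₁ f₂
    R8-slack-splitter refl he₂ tf₁ tf₂
      with R8-slack (sym tf₁) | R8-slack (trans he₂ (sym tf₁))
         | R8-slack (sym tf₂) | R8-slack (trans he₂ (sym tf₂))
    ... | inj₁ e₁ | inj₁ e₂ | _       | _       = inj₁ (e₁ , e₂)
    ... | _       | _       | inj₁ e₁ | inj₁ e₂ = inj₁ (e₁ , e₂)
    ... | inj₂ f₁ | _       | inj₂ f₂ | _       = inj₂ (f₁ , f₂)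
    ... | inj₂ f₁ | _       | _       | inj₂ f₂ = inj₂ (f₁ , f₂)
    ... | _       | inj₂ f₁ | inj₂ f₂ | _       = inj₂ (f₁ , f₂)
    ... | _       | inj₂ f₁ | _       | inj₂ f₂ = inj₂ (f₁ , f₂)

  change-balance : ∀ {c t t' F F' s e₁ e₂ f₁ f₂} →
    IsSteadyState R N c t F → IsSteadyState R N c t' F' →
    kind s ≡ splitter →
    e₁ ≢ e₂ → head e₁ ≡ s → head e₂ ≡ s → f₁ ≢ f₂ → tail f₁ ≡ s → tail f₂ ≡ s →
    (t' e₁ - t e₁) + (t' e₂ - t e₂) ≡ (t' f₁ - t f₁) + (t' f₂ - t f₂)
  change-balance {t = t} {t'} {e₁ = e₁} {e₂} {f₁} {f₂} S S' ks e≢ he₁ he₂ f≢ tf₁ tf₂ = begin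
    (t' e₁ - t e₁) + (t' e₂ - t e₂)    ≡⟨ +-minus-interchange _ _ _ _ ⟩
    (t' e₁ + t' e₂) - (t e₁ + t e₂)
      ≡⟨ cong₂ _-_ (IsSteadyState.R5 S' _ _ _ _ _ ks e≢ he₁ he₂ f≢ tf₁ tf₂)
                   (IsSteadyState.R5 S  _ _ _ _ _ ks e≢ he₁ he₂ f≢ tf₁ tf₂) ⟩
    (t' f₁ + t' f₂) - (t f₁ + t f₂)    ≡⟨ sym (+-minus-interchange _ _ _ _) ⟩
    (t' f₁ - t f₁) + (t' f₂ - t f₂)    ∎
    where open ≡-Reasoning

  -- Flux balance at each vertex and its sum over the network.

  module _ {c : Fin nV → ℝ} {t t' : Flow} {F F' : Fluidity}
           (S : IsSteadyState R N c t F) (S' : IsSteadyState R N c t' F') where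
    private
      module S  = IsSteadyState S
      module S' = IsSteadyState S'

    arcFlux : Flow
    arcFlux e = flux (F e) (F' e) (t e) (t' e)

    -- It suffices to compare all four fluxes with the same signed change, `t' - t` or `t - t'`,
    -- since R5 makes its incoming and outgoing totals equal.
    splitter-flux : ∀ {s e₁ e₂ f₁ f₂} → kind s ≡ splitter →
      e₁ ≢ e₂ → head e₁ ≡ s → head e₂ ≡ s → f₁ ≢ f₂ → tail f₁ ≡ s → tail f₂ ≡ s →
      arcFlux f₁ + arcFlux f₂ ≤ arcFlux e₁ + arcFlux e₂
    splitter-flux {s} {e₁} {e₂} {f₁} {f₂} ks e≢ he₁ he₂ f≢ tf₁ tf₂ =
      conclude (R8-slack-splitter S (proj₂ ∘ S'.range) he₁ he₂ tf₁ tf₂)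
               (R8-slack-splitter S' (proj₂ ∘ S.range) he₁ he₂ tf₁ tf₂)
      where
      open ≤-Reasoning
      InSlack  = Both (Slack true F t t') e₁ e₂
      InSlack' = Both (Slack true F' t' t) e₁ e₂
      OutSlack  = Both (Slack false F t t') f₁ f₂
      OutSlack' = Both (Slack false F' t' t) f₁ f₂

      via-increase : InSlack → OutSlack' → arcFlux f₁ + arcFlux f₂ ≤ arcFlux e₁ + arcFlux e₂
      via-increase (a₁ , a₂) (b₁ , b₂) = begin
        arcFlux f₁ + arcFlux f₂          ≤⟨ +-mono₂-≤ (flux≤y-x (F f₁) (F' f₁) b₁) (flux≤y-x (F f₂) (F' f₂) b₂) ⟩
        (t' f₁ - t f₁) + (t' f₂ - t f₂)  ≡⟨ sym (change-balance S S' ks e≢ he₁ he₂ f≢ tf₁ tf₂) ⟩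
        (t' e₁ - t e₁) + (t' e₂ - t e₂)  ≤⟨ +-mono₂-≤ (y-x≤flux (F e₁) (F' e₁) a₁) (y-x≤flux (F e₂) (F' e₂) a₂) ⟩
        arcFlux e₁ + arcFlux e₂          ∎

      via-decrease : InSlack' → OutSlack → arcFlux f₁ + arcFlux f₂ ≤ arcFlux e₁ + arcFlux e₂
      via-decrease (a₁ , a₂) (b₁ , b₂) = begin
        arcFlux f₁ + arcFlux f₂          ≤⟨ +-mono₂-≤ (flux≤x-y (F f₁) (F' f₁) b₁) (flux≤x-y (F f₂) (F' f₂) b₂) ⟩
        (t f₁ - t' f₁) + (t f₂ - t' f₂)  ≡⟨ sym (change-balance S' S ks e≢ he₁ he₂ f≢ tf₁ tf₂) ⟩
        (t e₁ - t' e₁) + (t e₂ - t' e₂)  ≤⟨ +-mono₂-≤ (x-y≤flux (F e₁) (F' e₁) a₁) (x-y≤flux (F e₂) (F' e₂) a₂) ⟩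
        arcFlux e₁ + arcFlux e₂          ∎

      in-pair : InSlack ⊎ InSlack'
      in-pair = slack-pair true F F' t t'
        (S.R6 s e₁ e₂ ks e≢ he₁ he₂) (S.R6 s e₂ e₁ ks (≢-sym e≢) he₂ he₁)
        (S'.R6 s e₁ e₂ ks e≢ he₁ he₂) (S'.R6 s e₂ e₁ ks (≢-sym e≢) he₂ he₁)

      out-pair : OutSlack ⊎ OutSlack'
      out-pair = slack-pair false F F' t t'
        (S.R7 s f₁ f₂ ks f≢ tf₁ tf₂) (S.R7 s f₂ f₁ ks (≢-sym f≢) tf₂ tf₁)
        (S'.R7 s f₁ f₂ ks f≢ tf₁ tf₂) (S'.R7 s f₂ f₁ ks (≢-sym f≢) tf₂ tf₁)

      -- A usable combination has incoming slack from one state and outgoing slack from the other.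
      -- When R8 gives the same side for both states, R6 or R7 supplies the opposite side for one of
      -- them.
      conclude : InSlack ⊎ OutSlack → InSlack' ⊎ OutSlack' →
                 arcFlux f₁ + arcFlux f₂ ≤ arcFlux e₁ + arcFlux e₂
      conclude (inj₁ a) (inj₂ b') = via-increase a b'
      conclude (inj₂ b) (inj₁ a') = via-decrease a' b
      conclude (inj₁ a) (inj₁ a') = [ via-decrease a' , via-increase a ]′ out-pair
      conclude (inj₂ b) (inj₂ b') =
        [ (λ a → via-increase a b') , (λ a' → via-decrease a' b) ]′ in-pair

    -- An arc that is fluid in one state carries the full capacity there, which the other state
    -- cannot exceed. The two bounds together say that the flux is at most `-|t' - t|`.
    input-flux : ∀ {e} → kind (tail e) ≡ input →
      arcFlux e ≤ t' e - t e × arcFlux e ≤ t e - t' e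
    input-flux {e} ki =
      flux≤y-x (F e) (F' e) (Sum.map₂ (λ F'e → subst (t e ≤_) (sym (proj₂ r' F'e)) (proj₁ r))
                                      (Sum.swap (≡⊎≡not (F' e) true))) ,
      flux≤x-y (F e) (F' e) (Sum.map₂ (λ Fe → subst (t' e ≤_) (sym (proj₂ r Fe)) (proj₁ r'))
                                      (Sum.swap (≡⊎≡not (F e) true)))
      where
      r  = S.R3 (tail e) e ki refl
      r' = S'.R3 (tail e) e ki refl

    -- Dual to inputs: an arc saturated in one state carries the full capacity there, so the flux is
    -- at least `|t' - t|`.
    output-flux : ∀ {e} → kind (head e) ≡ output →
      t' e - t e ≤ arcFlux e × t e - t' e ≤ arcFlux e
    output-flux {e} ko =
      y-x≤flux (F e) (F' e) (Sum.map₂ (λ Fe → subst (t' e ≤_) (sym (proj₂ r Fe)) (proj₁ r'))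
                                      (≡⊎≡not (F e) true)) ,
      x-y≤flux (F e) (F' e) (Sum.map₂ (λ F'e → subst (t e ≤_) (sym (proj₂ r' F'e)) (proj₁ r))
                                      (≡⊎≡not (F' e) true))
      where
      r  = S.R4 (head e) e ko refl
      r' = S'.R4 (head e) e ko refl

    influx outflux : Fin nV → ℝ
    influx  = ∑fibre head arcFlux
    outflux = ∑fibre tail arcFlux

    input-vertex : ∀ {e} → kind (tail e) ≡ input →
      influx (tail e) ≡ 0ℝ × outflux (tail e) ≡ arcFlux e
    input-vertex {e} ki with proj₁ (wellFormed (tail e)) ki
    ... | (e₀ , te₀ , unique) , noIn =
      ∑fibre-none head arcFlux noIn ,
      trans (∑fibre-one tail arcFlux te₀ unique) (cong arcFlux (sym (unique e refl)))

    output-vertex : ∀ {e} → kind (head e) ≡ output →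
      influx (head e) ≡ arcFlux e × outflux (head e) ≡ 0ℝ
    output-vertex {e} ko with proj₁ (proj₂ (wellFormed (head e))) ko
    ... | (e₀ , he₀ , unique) , noOut =
      trans (∑fibre-one head arcFlux he₀ unique) (cong arcFlux (sym (unique e refl))) ,
      ∑fibre-none tail arcFlux noOut

    outflux≤influx : ∀ v → outflux v ≤ influx v
    outflux≤influx v with kind v in kv
    ... | input with proj₁ (wellFormed v) kv
    ...   | (e , refl , _) , _ with input-vertex kv | input-flux kv
    ...     | in≡ , out≡ | ≤₁ , ≤₂ =
      subst₂ _≤_ (sym out≡) (sym in≡) (≤-differences⇒≤0 ≤₁ ≤₂)
    outflux≤influx v | output with proj₁ (proj₂ (wellFormed v)) kv
    ...   | (e , refl , _) , _ with output-vertex kv | output-flux kv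
    ...     | in≡ , out≡ | ≥₁ , ≥₂ =
      subst₂ _≤_ (sym out≡) (sym in≡) (differences-≤⇒0≤ ≥₁ ≥₂)
    outflux≤influx v | splitter with proj₂ (proj₂ (wellFormed v)) kv
    ...   | (e₁ , e₂ , e≢ , he₁ , he₂ , onlyIn) , (f₁ , f₂ , f≢ , tf₁ , tf₂ , onlyOut) =
      subst₂ _≤_ (sym (∑fibre-two tail arcFlux f≢ tf₁ tf₂ onlyOut))
                 (sym (∑fibre-two head arcFlux e≢ he₁ he₂ onlyIn))
                 (splitter-flux kv e≢ he₁ he₂ f≢ tf₁ tf₂)

    -- Every arc has one tail and one head, so both totals equal the sum of `arcFlux` over all arcs,
    -- and no vertex can lose flux.
    outflux≡influx : ∀ v → outflux v ≡ influx v
    outflux≡influx = ∑-≤-≡⇒≗ outflux influx outflux≤influx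
      (trans (∑-∑fibre tail arcFlux) (sym (∑-∑fibre head arcFlux)))

    -- A boundary vertex has no arcs on its other side, so equality there makes the flux of `e`
    -- zero; the boundary bounds then give both inequalities.
    boundary-agree : ∀ e → Boundary R N e → t e ≡ t' e
    boundary-agree e (inj₁ ki) with input-vertex ki | input-flux ki
    ... | in≡ , out≡ | ≤₁ , ≤₂ =
      antisym (0≤x-y⇒y≤x (subst (_≤ t' e - t e) flux≡0 ≤₁))
              (0≤x-y⇒y≤x (subst (_≤ t e - t' e) flux≡0 ≤₂))
      where flux≡0 = trans (sym out≡) (trans (outflux≡influx (tail e)) in≡)
    boundary-agree e (inj₂ ko) with output-vertex ko | output-flux ko
    ... | in≡ , out≡ | ≥₁ , ≥₂ =
      antisym (x-y≤0⇒x≤y (subst (t e - t' e ≤_) flux≡0 ≥₂))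
              (x-y≤0⇒x≤y (subst (t' e - t e ≤_) flux≡0 ≥₁))
      where flux≡0 = trans (sym in≡) (trans (sym (outflux≡influx (head e))) out≡)

theorem8 : (R : RealField) (N : SplitterNetwork)
    (c : Fin (SplitterNetwork.nV N) → RealField.ℝ R) →
    (∀ v → InUnit R (c v)) →
    (t t' : Fin (SplitterNetwork.nE N) → RealField.ℝ R) →
    (F F' : Fin (SplitterNetwork.nE N) → Bool) →
    IsSteadyState R N c t F → IsSteadyState R N c t' F' →
    ∀ e → Boundary R N e → t e ≡ t' e
theorem8 R N _ _ _ _ _ _ S S' = Comparison.boundary-agree R N S S'
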